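{- Let $n\geq 4$ be even. Let $\Psi$ be an instance of $\{1,2\}$-CSP whose graph $G$ is connected and bipartite, and assume $\mathbf{P}_\infty\models\Psi$. Then the following are equivalent: (I) $\mathbf{P}_n\models\Psi$; (II) Prover has a winning strategy in the game $\mathscr{G}(\Psi,\mathbf{P}_n)$; (III) there is no vertex $v$ of $G$ with $\gamma(v)\geq n/2$.
   Context: $\mathbf{P}_n$ is the path on $\{1,\ldots,n\}$, $\mathbf{P}_\infty$ the path on $\mathbb{Z}$ (edges between integers at distance 1). An instance $\Psi$ of $\{1,2\}$-CSP is a sentence in which each variable $v$ is quantified by $\exists^{\geq\beta(v)}$, $\beta(v)\in\{1,2\}$ ($\exists^{\geq j}$: at least $j$ distinct elements), followed by a conjunction of atoms $E(v_i,v_k)$; $G$ is the graph on the variables with an edge for each atom and $\prec$ the quantification order; for sets $X\prec Y$ means $x\prec y$ for all $x\in X,y\in Y$. Game $\mathscr{G}(\Psi,\mathbf{B})$: in order $\prec$, for each $v$ Prover offers $\beta(v)$ distinct elements of $\mathbf{B}$ and Adversary picks one as $f(v)$; Prover wins if $f$ is a homomorphism $G\to\mathbf{B}$. For a walk $Q=x_1,\ldots,x_r$, $|Q|=r-1$ and $\lambda(Q)=|Q|-2\sum_{i=2}^{r-1}(\beta(x_i)-1)$. A walk is looping if $x_1\neq x_r$ and, when $r\geq 3$, $\{x_1,x_r\}\prec\{x_2,\ldots,x_{r-1}\}$ and there is $\ell\notin\{1,r\}$ with $x_1,\ldots,x_\ell$ and $x_\ell,\ldots,x_r$ both looping (for $r=2$: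 two distinct adjacent vertices). $\delta(u,v)$ is the minimum $\lambda(Q)$ over looping walks with endpoints $u,v$, and $\infty$ if none. $\gamma$ is defined recursively along $\prec$: $\gamma(v)=0$ if $v$ is the first vertex; otherwise $\gamma(v)=\beta(v)-1+\max\{0,\max_{u\prec v}(\gamma(u)-\delta(u,v)+\beta(v)-1)\}$ (terms with $\delta(u,v)=\infty$ contribute $-\infty$). -}

module Defs where

open import Data.Nat as ℕ using (ℕ; zero; suc)
open import Data.Integer as ℤ using (ℤ; +_)
open import Data.Fin using (Fin; toℕ) renaming (zero to fzero; suc to fsuc)
open import Data.Fin.Properties using (_≟_)
open import Data.Bool using (Bool; true; false; if_then_else_)
open import Data.List using (List; []; _∷_; _++_; length; map; allFin)
open import Data.Nat.ListAction using (sum)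
open import Data.List.Relation.Unary.All using (All)
open import Data.List.Membership.Propositional using (_∈_)
open import Data.Maybe using (Maybe; just; nothing)
open import Data.Product using (Σ; Σ-syntax; _×_; _,_; proj₁; proj₂)
open import Data.Sum using (_⊎_)
open import Relation.Nullary using (¬_; does)
open import Relation.Binary.PropositionalEquality using (_≡_; _≢_)
open import Relation.Binary.Construct.Closure.ReflexiveTransitive using (Star)

record Str : Set₁ where
  field
    D : Set
    E : D → D → Set
open Str public

P∞ : Str
P∞ = record { D = ℤ ; E = λ a b → (a ℤ.+ + 1 ≡ b) ⊎ (b ℤ.+ + 1 ≡ a) }

-- Pₙ : path on n vertices, realised on Fin n (vertex i ↦ i+1 of {1..n})
P : ℕ → Str
P n = record { D = Fin n ; E = λ i j → (toℕ i ℕ.+ 1 ≡ toℕ j) ⊎ (toℕ j ℕ.+ 1 ≡ toℕ i) }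

-- Instances of {1,2}-CSP.
-- Variables are Fin m, quantified in the order 0,1,…,m-1 (so ≺ is <
-- on Fin m).  two v = true  iff  β(v) = 2.

record Instance : Set where
  field
    m     : ℕ
    two   : Fin m → Bool
    atoms : List (Fin m × Fin m)
open Instance public

β-1 : (Ψ : Instance) → Fin (m Ψ) → ℕ
β-1 Ψ v = if two Ψ v then 1 else 0

_≺_ : ∀ {k} → Fin k → Fin k → Set
u ≺ v = toℕ u ℕ.< toℕ v

Hom : (Ψ : Instance) (B : Str) → (Fin (m Ψ) → D B) → Set
Hom Ψ B f = All (λ e → E B (f (proj₁ e)) (f (proj₂ e))) (atoms Ψ)

update : ∀ {k} {A : Set} → (Fin k → A) → Fin k → A → Fin k → A
update ρ v a u = if does (u ≟ v) then a else ρ u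

SatQ : (Ψ : Instance) (B : Str) → (Fin (m Ψ) → D B) → Fin (m Ψ) → Bool →
       List (Fin (m Ψ)) → Set
Sat : (Ψ : Instance) (B : Str) → (Fin (m Ψ) → D B) → List (Fin (m Ψ)) → Set
Sat Ψ B ρ [] = Hom Ψ B ρ
Sat Ψ B ρ (v ∷ vs) = SatQ Ψ B ρ v (two Ψ v) vs
SatQ Ψ B ρ v false vs = Σ[ a ∈ D B ] Sat Ψ B (update ρ v a) vs
SatQ Ψ B ρ v true vs  = Σ[ a ∈ D B ] Σ[ b ∈ D B ]
  (a ≢ b) × Sat Ψ B (update ρ v a) vs × Sat Ψ B (update ρ v b) vs

-- B ⊨ Ψ  (the initial assignment is irrelevant since every variable is bound)
_⊨_ : Str → Instance → Set
B ⊨ Ψ = (ρ : Fin (m Ψ) → D B) → Sat Ψ B ρ (allFin (m Ψ))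

-- The game 𝒢(Ψ,B).
-- A Prover strategy gives, for each variable v and each assignment (of which
-- only the values of variables ≺ v may be used), an offer of elements:
-- the first component when β(v)=1, both (distinct) components when β(v)=2.

Strategy : Instance → Str → Set
Strategy Ψ B = Fin (m Ψ) → (Fin (m Ψ) → D B) → D B × D B

ValidStrategy : (Ψ : Instance) (B : Str) → Strategy Ψ B → Set
ValidStrategy Ψ B σ =
  ((v : Fin (m Ψ)) (ρ : Fin (m Ψ) → D B) → two Ψ v ≡ true →
      proj₁ (σ v ρ) ≢ proj₂ (σ v ρ))
  × ((v : Fin (m Ψ)) (ρ ρ' : Fin (m Ψ) → D B) →
      ((u : Fin (m Ψ)) → u ≺ v → ρ u ≡ ρ' u) → σ v ρ ≡ σ v ρ')

Picked : (Ψ : Instance) (B : Str) → Strategy Ψ B → (Fin (m Ψ) → D B) →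
         Fin (m Ψ) → Bool → Set
Picked Ψ B σ f v false = f v ≡ proj₁ (σ v f)
Picked Ψ B σ f v true  = (f v ≡ proj₁ (σ v f)) ⊎ (f v ≡ proj₂ (σ v f))

PlayedBy : (Ψ : Instance) (B : Str) → Strategy Ψ B → (Fin (m Ψ) → D B) → Set
PlayedBy Ψ B σ f = (v : Fin (m Ψ)) → Picked Ψ B σ f v (two Ψ v)

ProverWins : Instance → Str → Set
ProverWins Ψ B = Σ[ σ ∈ Strategy Ψ B ] ValidStrategy Ψ B σ ×
  ((f : Fin (m Ψ) → D B) → PlayedBy Ψ B σ f → Hom Ψ B f)

Adj : (Ψ : Instance) → Fin (m Ψ) → Fin (m Ψ) → Set
Adj Ψ u w = ((u , w) ∈ atoms Ψ) ⊎ ((w , u) ∈ atoms Ψ)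

Connected : Instance → Set
Connected Ψ = (u w : Fin (m Ψ)) → Star (Adj Ψ) u w

Bipartite : Instance → Set
Bipartite Ψ = Σ[ c ∈ (Fin (m Ψ) → Bool) ]
  All (λ e → c (proj₁ e) ≢ c (proj₂ e)) (atoms Ψ)

-- Looping walks.  Looping Ψ u I w : the walk u , I , w (I = interior
-- vertices x₂ … x_{r-1}) is looping.

data Looping (Ψ : Instance) : Fin (m Ψ) → List (Fin (m Ψ)) → Fin (m Ψ) → Set where
  edge  : ∀ {u w} → u ≢ w → Adj Ψ u w → Looping Ψ u [] w
  split : ∀ {u z w I₁ I₂} →
          Looping Ψ u I₁ z → Looping Ψ z I₂ w → u ≢ w →
          All (u ≺_) (I₁ ++ z ∷ I₂) → All (w ≺_) (I₁ ++ z ∷ I₂) →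
          Looping Ψ u (I₁ ++ z ∷ I₂) w

-- λ(Q) = |Q| - 2 Σ_{interior} (β - 1),  with |Q| = length I + 1
λw : (Ψ : Instance) → List (Fin (m Ψ)) → ℤ
λw Ψ I = + (length I ℕ.+ 1) ℤ.- + (2 ℕ.* sum (map (β-1 Ψ) I))

-- IsDelta Ψ u v d : δ(u,v) = d  (nothing = ∞)
IsDelta : (Ψ : Instance) → Fin (m Ψ) → Fin (m Ψ) → Maybe ℤ → Set
IsDelta Ψ u v nothing  = (I : List (Fin (m Ψ))) → ¬ Looping Ψ u I v
IsDelta Ψ u v (just d) =
  (Σ[ I ∈ List (Fin (m Ψ)) ] Looping Ψ u I v × λw Ψ I ≡ d)
  × ((I : List (Fin (m Ψ))) → Looping Ψ u I v → d ℤ.≤ λw Ψ I)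

-- γ(v) for v not the first vertex, written relationally:
-- g v = b + max(0, max_{u ≺ v, δ(u,v)=d finite} (g u - d + b)),  b = β(v)-1.
GammaStep : (Ψ : Instance) → (Fin (m Ψ) → ℤ) → Fin (m Ψ) → Set
GammaStep Ψ g v =
  (b ℤ.≤ g v)
  × ((u : Fin (m Ψ)) (d : ℤ) → u ≺ v → IsDelta Ψ u v (just d) →
       b ℤ.+ (g u ℤ.- d ℤ.+ b) ℤ.≤ g v)
  × ((g v ≡ b) ⊎
     (Σ[ u ∈ Fin (m Ψ) ] Σ[ d ∈ ℤ ] u ≺ v × IsDelta Ψ u v (just d) ×
        (g v ≡ b ℤ.+ (g u ℤ.- d ℤ.+ b))))
  where
  b = + β-1 Ψ v

IsGamma : (Ψ : Instance) → (Fin (m Ψ) → ℤ) → Set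
IsGamma Ψ g = (v : Fin (m Ψ)) →
  (toℕ v ≡ 0 → g v ≡ + 0) × (¬ (toℕ v ≡ 0) → GammaStep Ψ g v)

{-# OPTIONS --safe #-}
module Submission where

-- Eliminating the last vertex z from constraints |f(u) − f(z)| ≤ d(u,z) yields
-- |f(u) − f(w)| ≤ d(u,z) + d(z,w) − 2(β(z) − 1): all values of one vertex have the same parity, so two
-- distinct offers differ by at least 2. Iterating this gives |f(u) − f(w)| ≤ δ(u,w) in every won play.
--
-- On the path with 2K vertices γ(v) is the distance from the middle edge to which Adversary can push v.
-- At v, he takes the vertex u attaining the maximum in γ(v) and picks the offer on the side of u away
-- from the middle; hence γ(v) < K if Prover wins.
--
-- Conversely Prover keeps v within distance γ(v) of the middle edge. The admissible values form
-- intervals in one parity class, and these overlap pairwise in at least β(v) values by the recursion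
-- for γ, by the triangle inequality for δ, and by δ(u,v) ≥ β(v) − 1, which P∞ ⊨ Ψ guarantees. By the
-- one-dimensional Helly property she can offer the leftmost common value M, and M + 2.

open import Defs
open import Data.Bool using (Bool; true; false; if_then_else_)
open import Data.Empty using (⊥-elim)
open import Data.Fin using (Fin; toℕ; fromℕ<; zero; suc)
open import Data.Fin.Induction using (<-wellFounded)
import Data.Fin.Properties as Fin
open import Data.Integer using (ℤ; +_; -[1+_]; 0ℤ; 1ℤ; _+_; _-_; _*_; -_; _≤_; _<_; +≤+; -≤+; -≤-; +<+; _≤?_)
open import Data.Integer.DivMod using (_%ℕ_; _/ℕ_; a≡a%ℕn+[a/ℕn]*n; n%ℕd<d)
import Data.Integer.Properties as ℤ
open import Data.Integer.Tactic.RingSolver using (solve)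
open import Data.List using (List; []; _∷_; _++_; length; map; allFin; tabulate)
import Data.List.Membership.DecPropositional as DecMembership
import Data.List.Properties as List
open import Data.List.Relation.Unary.All as All using (All)
import Data.List.Relation.Unary.All.Properties as All
open import Data.Maybe using (just)
open import Data.Nat as ℕ using (ℕ; zero; suc; z≤n; s≤s)
open import Data.Nat.Divisibility using (_∣_; divides)
open import Data.Nat.DivMod using (_/_; m*n/n≡m)
open import Data.Nat.ListAction using (sum)
open import Data.Nat.ListAction.Properties using (sum-++)
import Data.Nat.Properties as ℕ
open import Data.Product using (Σ; Σ-syntax; _×_; _,_; proj₁; proj₂)
open import Data.Product.Properties using (≡-dec)
open import Data.Sum as Sum using (_⊎_; inj₁; inj₂; swap)
open import Function using (flip; _∘_)
open import Function.Bundles using (_⇔_; mk⇔)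
import Induction.WellFounded as WF
open import Level using (0ℓ)
open import Relation.Binary.Construct.Closure.ReflexiveTransitive using (Star; ε; _◅_)
open import Relation.Binary.Definitions using (Tri; tri<; tri≈; tri>)
open import Relation.Binary.PropositionalEquality
open import Relation.Nullary using (¬_; Dec; yes; no; contradiction; Irrelevant)
open import Relation.Nullary.Decidable using (_×-dec_; _⊎-dec_; ¬?)

-- Linear arithmetic and parity of integers

-- Certificate form of linear arithmetic: the hypotheses are added up to a single `p ≤ q`, and the
-- ring solver checks that its slack is the slack of the goal.
linear : ∀ {p q x y} → p ≤ q → q - p ≡ y - x → x ≤ y
linear p≤q e = ℤ.0≤i-j⇒j≤i (subst (0ℤ ≤_) e (ℤ.i≤j⇒0≤j-i p≤q))

infixr 5 _⊕_
_⊕_ : ∀ {i j k l} → i ≤ j → k ≤ l → i + k ≤ j + l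
_⊕_ = ℤ.+-mono-≤

data Even : ℤ → Set where
  double : ∀ k {x} → x ≡ k + k → Even x

Even-resp : ∀ {x y} → Even x → x ≡ y → Even y
Even-resp e refl = e

Even-+ : ∀ {x y} → Even x → Even y → Even (x + y)
Even-+ (double k refl) (double l refl) = double (k + l) (solve (k ∷ l ∷ []))

Even-neg : ∀ {x} → Even x → Even (- x)
Even-neg (double k refl) = double (- k) (solve (k ∷ []))

parity : ∀ x → Even x ⊎ Even (x + 1ℤ)
parity x with x %ℕ 2 | x /ℕ 2 | a≡a%ℕn+[a/ℕn]*n x 2 | n%ℕd<d x 2
... | 0 | q | x≡ | _ = inj₁ (double q (trans x≡ (even q)))
  where
  even : ∀ q → 0ℤ + q * + 2 ≡ q + q
  even q = trans (ℤ.+-identityˡ _) (trans (ℤ.*-distribˡ-+ q 1ℤ 1ℤ)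
    (cong₂ _+_ (ℤ.*-identityʳ q) (ℤ.*-identityʳ q)))
... | 1 | q | x≡ | _ = inj₂ (double (q + 1ℤ) (trans (cong (_+ 1ℤ) x≡) (odd q)))
  where
  odd : ∀ q → 1ℤ + q * + 2 + 1ℤ ≡ (q + 1ℤ) + (q + 1ℤ)
  odd q = solve (q ∷ [])
... | suc (suc _) | _ | _ | s≤s (s≤s ())

Even-nonneg : ∀ {x} → Even x → - 1ℤ ≤ x → 0ℤ ≤ x
Even-nonneg (double (+ k) refl) _ = +≤+ z≤n
Even-nonneg (double -[1+ k ] refl) (-≤- ())

-- The slack `y - x` is even and at least -1, hence nonnegative. This absorbs the rounding error of
-- one that parity alignment causes.
Even-sharpen : ∀ {x y} → Even (y - x) → x ≤ y + 1ℤ → x ≤ y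
Even-sharpen {x} {y} e x≤y+1 =
  linear (Even-nonneg e (linear x≤y+1 (solve (x ∷ y ∷ [])))) (solve (x ∷ y ∷ []))

infix 4 _≡₂_
_≡₂_ : ℤ → ℤ → Set
x ≡₂ y = Even (x - y)

≡₂-refl : ∀ {x} → x ≡₂ x
≡₂-refl {x} = double 0ℤ (ℤ.+-inverseʳ x)

≡₂-sym : ∀ {x y} → x ≡₂ y → y ≡₂ x
≡₂-sym {x} {y} e = Even-resp (Even-neg e) (solve (x ∷ y ∷ []))

≡₂-trans : ∀ {x y z} → x ≡₂ y → y ≡₂ z → x ≡₂ z
≡₂-trans {x} {y} {z} e f = Even-resp (Even-+ e f) (solve (x ∷ y ∷ z ∷ []))

-- Attained minima and maxima over finitely generated sets

module Extrema {A : Set} {_≼_ : A → A → Set}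
  (total : ∀ x y → x ≼ y ⊎ y ≼ x) (≼-trans : ∀ {x y z} → x ≼ y → y ≼ z → x ≼ z) where

  Least : (A → Set) → A → Set
  Least P x = P x × (∀ {y} → P y → x ≼ y)

  -- The left alternative plays the part of the value ∞ of δ.
  HasLeast : (A → Set) → Set
  HasLeast P = (∀ {x} → ¬ P x) ⊎ Σ A (Least P)

  ≼-refl : ∀ {x} → x ≼ x
  ≼-refl {x} with total x x
  ... | inj₁ p = p
  ... | inj₂ p = p

  map-least : ∀ {P Q} → (∀ {x} → P x → Q x) → (∀ {x} → Q x → P x) → HasLeast P → HasLeast Q
  map-least f g (inj₁ ¬p)            = inj₁ (¬p ∘ g)
  map-least f g (inj₂ (x , p , low)) = inj₂ (x , f p , low ∘ g)

  least-≡ : ∀ a → HasLeast (_≡ a)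
  least-≡ a = inj₂ (a , refl , λ { refl → ≼-refl })

  least-⊎ : ∀ {P Q} → HasLeast P → HasLeast Q → HasLeast (λ x → P x ⊎ Q x)
  least-⊎ (inj₁ ¬p) (inj₁ ¬q) = inj₁ λ { (inj₁ p) → ¬p p ; (inj₂ q) → ¬q q }
  least-⊎ (inj₁ ¬p) (inj₂ (y , q , low)) =
    inj₂ (y , inj₂ q , λ { (inj₁ p) → ⊥-elim (¬p p) ; (inj₂ q′) → low q′ })
  least-⊎ (inj₂ (x , p , low)) (inj₁ ¬q) =
    inj₂ (x , inj₁ p , λ { (inj₁ p′) → low p′ ; (inj₂ q) → ⊥-elim (¬q q) })
  least-⊎ (inj₂ (x , p , lowx)) (inj₂ (y , q , lowy)) with total x y
  ... | inj₁ x≼y = inj₂ (x , inj₁ p , λ { (inj₁ p′) → lowx p′ ; (inj₂ q′) → ≼-trans x≼y (lowy q′) })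
  ... | inj₂ y≼x = inj₂ (y , inj₂ q , λ { (inj₁ p′) → ≼-trans y≼x (lowx p′) ; (inj₂ q′) → lowy q′ })

  least-Fin : ∀ {k} {P : Fin k → A → Set} → (∀ i → HasLeast (P i)) →
              HasLeast (λ x → Σ[ i ∈ Fin k ] P i x)
  least-Fin {zero}  h = inj₁ λ ()
  least-Fin {suc k} h = map-least
    (λ { (inj₁ p) → zero , p ; (inj₂ (i , p)) → suc i , p })
    (λ { (zero , p) → inj₁ p ; (suc i , p) → inj₂ (i , p) })
    (least-⊎ (h zero) (least-Fin (h ∘ suc)))

  least-Σ : ∀ {B : Set} {P : B → A → Set} → Dec B → Irrelevant B → (∀ b → HasLeast (P b)) →
            HasLeast (λ x → Σ[ b ∈ B ] P b x)
  least-Σ (no ¬b) _ _ = inj₁ (¬b ∘ proj₁)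
  least-Σ {P = P} (yes b) irr h =
    map-least (b ,_) (λ { {x} (b′ , p) → subst (λ b → P b x) (irr b′ b) p }) (h b)

  HasLeastAlong : ∀ {B : Set} → (B → A) → (B → Set) → Set
  HasLeastAlong {B} f P = (∀ b → ¬ P b) ⊎ (Σ[ b ∈ B ] P b × (∀ {b′} → P b′ → f b ≼ f b′))

  least-image : ∀ {B : Set} {P : B → Set} (f : B → A) → HasLeastAlong f P →
    HasLeast (λ x → Σ[ b ∈ B ] P b × x ≡ f b)
  least-image f (inj₁ ¬p) = inj₁ λ { (b , p , _) → ¬p b p }
  least-image f (inj₂ (b , p , low)) = inj₂ (f b , (b , p , refl) , λ { (_ , p′ , refl) → low p′ })

module Min = Extrema ℤ.≤-total ℤ.≤-trans
module Max = Extrema {_≼_ = flip _≤_} (flip ℤ.≤-total) (flip ℤ.≤-trans)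

greatest-unique : ∀ {P Q : ℤ → Set} {x y} → (∀ {z} → P z → Q z) → (∀ {z} → Q z → P z) →
                  Max.Least P x → Max.Least Q y → x ≡ y
greatest-unique f g (p , ubx) (q , uby) = ℤ.≤-antisym (uby (f p)) (ubx (g q))

-- Looping walks, δ and γ

module Walks (Ψ : Instance) where

  V : Set
  V = Fin (m Ψ)

  b : V → ℤ
  b v = + β-1 Ψ v

  b≥0 : ∀ v → 0ℤ ≤ b v
  b≥0 v = +≤+ z≤n

  -- Weight u w d: some looping walk from u to w has λ = d, the split vertex being its least interior one.
  data Weight : V → V → ℤ → Set where
    edge  : ∀ {u w} → u ≢ w → Adj Ψ u w → Weight u w 1ℤ
    split : ∀ {u z w d e} → Weight u z d → Weight z w e → u ≢ w → u ≺ z → w ≺ z →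
            Weight u w (d + e - (b z + b z))

  Weight-sym : ∀ {u w d} → Weight u w d → Weight w u d
  Weight-sym (edge u≢w a) = edge (u≢w ∘ sym) (swap a)
  Weight-sym (split {z = z} {d = d} {e} p q u≢w u≺z w≺z) =
    subst (λ s → Weight _ _ (s - (b z + b z))) (ℤ.+-comm e d)
      (split (Weight-sym q) (Weight-sym p) (u≢w ∘ sym) w≺z u≺z)

  -- The edge counts of the two halves add up, and `z` is the only interior vertex that belongs to
  -- the interior of neither half.
  λw-split : ∀ I₁ z I₂ → λw Ψ (I₁ ++ z ∷ I₂) ≡ λw Ψ I₁ + λw Ψ I₂ - (b z + b z)
  λw-split I₁ z I₂ = begin
    + (length (I₁ ++ z ∷ I₂) ℕ.+ 1) - + (2 ℕ.* sum (map (β-1 Ψ) (I₁ ++ z ∷ I₂)))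
      ≡⟨ cong₂ (λ l s → + (l ℕ.+ 1) - + (2 ℕ.* s)) (List.length-++ I₁)
           (trans (cong sum (List.map-++ (β-1 Ψ) I₁ (z ∷ I₂))) (sum-++ (map (β-1 Ψ) I₁) _)) ⟩
    + (l₁ ℕ.+ suc l₂ ℕ.+ 1) - + (2 ℕ.* (s₁ ℕ.+ (β-1 Ψ z ℕ.+ s₂)))
      ≡⟨ cong (λ s → + (l₁ ℕ.+ suc l₂ ℕ.+ 1) - s) (ℤ.pos-* 2 (s₁ ℕ.+ (β-1 Ψ z ℕ.+ s₂))) ⟩
    (+ l₁ + (1ℤ + + l₂) + 1ℤ) - + 2 * (+ s₁ + (b z + + s₂))
      ≡⟨ regroup (+ l₁) (+ l₂) (+ s₁) (+ s₂) (b z) ⟩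
    (+ l₁ + 1ℤ - + 2 * + s₁) + (+ l₂ + 1ℤ - + 2 * + s₂) - (b z + b z)
      ≡⟨ cong₂ (λ x y → (+ l₁ + 1ℤ - x) + (+ l₂ + 1ℤ - y) - (b z + b z)) (ℤ.pos-* 2 s₁) (ℤ.pos-* 2 s₂) ⟨
    λw Ψ I₁ + λw Ψ I₂ - (b z + b z) ∎
    where
    open ≡-Reasoning
    l₁ = length I₁
    l₂ = length I₂
    s₁ = sum (map (β-1 Ψ) I₁)
    s₂ = sum (map (β-1 Ψ) I₂)
    regroup : ∀ l₁ l₂ s₁ s₂ c → (l₁ + (1ℤ + l₂) + 1ℤ) - + 2 * (s₁ + (c + s₂)) ≡
              (l₁ + 1ℤ - + 2 * s₁) + (l₂ + 1ℤ - + 2 * s₂) - (c + c)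
    regroup l₁ l₂ s₁ s₂ c = solve (l₁ ∷ l₂ ∷ s₁ ∷ s₂ ∷ c ∷ [])

  Looping⇒Weight : ∀ {u I w} → Looping Ψ u I w → Weight u w (λw Ψ I)
  Looping⇒Weight (edge u≢w a) = edge u≢w a
  Looping⇒Weight (split {z = z} {I₁ = I₁} {I₂} p q u≢w u≺ w≺)
    with u≺z All.∷ _ ← All.++⁻ʳ I₁ u≺ | w≺z All.∷ _ ← All.++⁻ʳ I₁ w≺ =
    subst (Weight _ _) (sym (λw-split I₁ z I₂))
      (split (Looping⇒Weight p) (Looping⇒Weight q) u≢w u≺z w≺z)

  -- The two `All` conditions strengthen the induction: the interiors of both halves lie above `z`,
  -- hence above `u` and `w`.
  Weight⇒Looping : ∀ {u w d} → Weight u w d →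
    Σ[ I ∈ List V ] Looping Ψ u I w × λw Ψ I ≡ d × All (u ≺_) I × All (w ≺_) I
  Weight⇒Looping (edge u≢w a) = [] , edge u≢w a , refl , All.[] , All.[]
  Weight⇒Looping (split {u} {z} {w} p q u≢w u≺z w≺z)
    with I₁ , l₁ , refl , u≺₁ , z≺₁ ← Weight⇒Looping p
       | I₂ , l₂ , refl , z≺₂ , w≺₂ ← Weight⇒Looping q =
    I₁ ++ z ∷ I₂ , split l₁ l₂ u≢w u≺ w≺ , λw-split I₁ z I₂ , u≺ , w≺
    where
    u≺ : All (u ≺_) (I₁ ++ z ∷ I₂)
    u≺ = All.++⁺ u≺₁ (u≺z All.∷ All.map (ℕ.<-trans u≺z) z≺₂)
    w≺ : All (w ≺_) (I₁ ++ z ∷ I₂)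
    w≺ = All.++⁺ (All.map (ℕ.<-trans w≺z) z≺₁) (w≺z All.∷ w≺₂)

  Delta : V → V → ℤ → Set
  Delta u w = Min.Least (Weight u w)

  IsDelta⇒Delta : ∀ {u w d} → IsDelta Ψ u w (just d) → Delta u w d
  IsDelta⇒Delta ((I , l , refl) , low) = Looping⇒Weight l , λ p →
    let I′ , l′ , e , _ = Weight⇒Looping p in subst (_ ≤_) e (low I′ l′)

  Delta⇒IsDelta : ∀ {u w d} → Delta u w d → IsDelta Ψ u w (just d)
  Delta⇒IsDelta (p , low) =
    (let I , l , e , _ = Weight⇒Looping p in I , l , e) , λ I l → low (Looping⇒Weight l)

  Adj? : ∀ u w → Dec (Adj Ψ u w)
  Adj? u w = ((u , w) ∈? atoms Ψ) ⊎-dec ((w , u) ∈? atoms Ψ)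
    where open DecMembership (≡-dec Fin._≟_ Fin._≟_)

  -- The least split point moves strictly up, so m − max(u,w) bounds the recursion.
  leastWeight′ : ∀ t u w → m Ψ ℕ.≤ t ℕ.+ toℕ u ⊎ m Ψ ℕ.≤ t ℕ.+ toℕ w → Min.HasLeast (Weight u w)
  leastWeight′ zero u w (inj₁ le) = contradiction (Fin.toℕ<n u) (ℕ.≤⇒≯ le)
  leastWeight′ zero u w (inj₂ le) = contradiction (Fin.toℕ<n w) (ℕ.≤⇒≯ le)
  leastWeight′ (suc t) u w bound = Min.map-least join unjoin
    (Min.least-⊎
      edges
      (Min.least-Fin λ z → splits z))
    where
    Inner : V → Set
    Inner z = u ≢ w × u ≺ z × w ≺ z

    Parts : V → ℤ × ℤ → Set
    Parts z (d , e) = Weight u z d × Weight z w e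

    total : V → ℤ × ℤ → ℤ
    total z (d , e) = d + e - (b z + b z)

    Split : V → ℤ → Set
    Split z x = Inner z × (Σ[ s ∈ ℤ × ℤ ] Parts z s × x ≡ total z s)

    join : ∀ {x} → ((u ≢ w × Adj Ψ u w) × x ≡ 1ℤ) ⊎ (Σ[ z ∈ V ] Split z x) → Weight u w x
    join (inj₁ ((u≢w , a) , refl)) = edge u≢w a
    join (inj₂ (z , (u≢w , u≺z , w≺z) , _ , (p , q) , refl)) = split p q u≢w u≺z w≺z

    unjoin : ∀ {x} → Weight u w x → ((u ≢ w × Adj Ψ u w) × x ≡ 1ℤ) ⊎ (Σ[ z ∈ V ] Split z x)
    unjoin (edge u≢w a) = inj₁ ((u≢w , a) , refl)
    unjoin (split p q u≢w u≺z w≺z) = inj₂ (_ , (u≢w , u≺z , w≺z) , _ , (p , q) , refl)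

    recbound : ∀ z → u ≺ z → w ≺ z → m Ψ ℕ.≤ t ℕ.+ toℕ z
    recbound z u≺z w≺z = Sum.[ step u≺z , step w≺z ] bound
      where
      step : ∀ {y} → y ≺ z → m Ψ ℕ.≤ suc t ℕ.+ toℕ y → m Ψ ℕ.≤ t ℕ.+ toℕ z
      step {y} y≺z le = ℕ.≤-trans le
        (ℕ.≤-trans (ℕ.≤-reflexive (sym (ℕ.+-suc t (toℕ y)))) (ℕ.+-monoʳ-≤ t y≺z))

    -- The two halves vary independently, so their sum is least when each of them is.
    parts : ∀ z → Min.HasLeast (Weight u z) → Min.HasLeast (Weight z w) →
            Min.HasLeastAlong (total z) (Parts z)
    parts z (inj₁ ¬p) _ = inj₁ λ _ pq → ¬p (proj₁ pq)
    parts z (inj₂ _) (inj₁ ¬q) = inj₁ λ _ pq → ¬q (proj₂ pq)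
    parts z (inj₂ (d , p , lowd)) (inj₂ (e , q , lowe)) =
      inj₂ ((d , e) , (p , q) , λ (p′ , q′) → ℤ.+-monoˡ-≤ (- (b z + b z)) (lowd p′ ⊕ lowe q′))

    edges : Min.HasLeast (λ x → (u ≢ w × Adj Ψ u w) × x ≡ 1ℤ)
    edges with ¬? (u Fin.≟ w) ×-dec Adj? u w
    ... | no ¬c = inj₁ (¬c ∘ proj₁)
    ... | yes c = Min.map-least (c ,_) proj₂ (Min.least-≡ 1ℤ)

    splits : ∀ z → Min.HasLeast (Split z)
    splits z with ¬? (u Fin.≟ w) ×-dec ((toℕ u ℕ.<? toℕ z) ×-dec (toℕ w ℕ.<? toℕ z))
    ... | no ¬c = inj₁ (¬c ∘ proj₁)
    ... | yes c@(_ , u≺z , w≺z) = Min.map-least (c ,_) proj₂ (Min.least-image (total z)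
      (parts z (leastWeight′ t u z (inj₂ (recbound z u≺z w≺z)))
               (leastWeight′ t z w (inj₁ (recbound z u≺z w≺z)))))

  leastWeight : ∀ u w → Min.HasLeast (Weight u w)
  leastWeight u w = leastWeight′ (m Ψ) u w (inj₁ (ℕ.m≤m+n (m Ψ) (toℕ u)))

  -- One shape for two maxima: the recursion for γ, and the leftmost common value in Prover's
  -- strategy. The proof of `u ≺ v` is passed to `f` because γ is available only below `v` during
  -- the recursion.
  Candidate : ℤ → (v : V) → (∀ u → u ≺ v → ℤ → ℤ) → ℤ → Set
  Candidate base v f x =
    x ≡ base ⊎ (Σ[ u ∈ V ] Σ[ u≺v ∈ u ≺ v ] Σ[ d ∈ ℤ ] Delta u v d × x ≡ f u u≺v d)

  -- There are finitely many `u`, and `leastWeight` decides for each whether δ is finite; `base`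
  -- keeps the set of candidates nonempty.
  greatest : ∀ base v f → (∀ u u≺v {d e} → d ≤ e → f u u≺v e ≤ f u u≺v d) →
             Σ ℤ (Max.Least (Candidate base v f))
  greatest base v f anti with Max.least-⊎ (Max.least-≡ base) (Max.least-Fin λ u →
      Max.least-Σ (toℕ u ℕ.<? toℕ v) ℕ.<-irrelevant λ u≺v →
        Max.least-image (f u u≺v) (onlyDelta u u≺v (leastWeight u v)))
    where
    onlyDelta : ∀ u u≺v → Min.HasLeast (Weight u v) → Max.HasLeastAlong (f u u≺v) (Delta u v)
    onlyDelta u u≺v (inj₁ ¬p) = inj₁ λ _ δ → ¬p (proj₁ δ)
    onlyDelta u u≺v (inj₂ (d , δ)) = inj₂ (d , δ , λ δ′ → anti u u≺v (proj₂ δ (proj₁ δ′)))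
  ... | inj₁ none = contradiction (inj₁ refl) none
  ... | inj₂ max  = max

  candidate-cong : ∀ {base base′ v f f′ x} → base ≡ base′ → (∀ u u≺v d → f u u≺v d ≡ f′ u u≺v d) →
                   Candidate base v f x → Candidate base′ v f′ x
  candidate-cong base≡ f≡ (inj₁ x≡) = inj₁ (trans x≡ base≡)
  candidate-cong base≡ f≡ (inj₂ (u , u≺v , d , δ , x≡)) =
    inj₂ (u , u≺v , d , δ , trans x≡ (f≡ u u≺v d))

  -- Pointwise equality of the terms suffices because a maximum is unique. This serves both the
  -- unfolding of γ and the locality of Prover's strategy.
  greatest-cong : ∀ {base base′ v f f′ anti anti′} → base ≡ base′ →
                  (∀ u u≺v d → f u u≺v d ≡ f′ u u≺v d) →
                  proj₁ (greatest base v f anti) ≡ proj₁ (greatest base′ v f′ anti′)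
  greatest-cong {base} {base′} {v} {f} {f′} {anti} {anti′} base≡ f≡ =
    greatest-unique (candidate-cong {v = v} base≡ f≡)
      (candidate-cong {v = v} (sym base≡) (λ u p d → sym (f≡ u p d)))
      (proj₂ (greatest base v f anti)) (proj₂ (greatest base′ v f′ anti′))

  gain : V → ℤ → ℤ → ℤ
  gain v g d = b v + (g - d + b v)

  gain-anti : ∀ v g {d e} → d ≤ e → gain v g e ≤ gain v g d
  gain-anti v g {d} {e} d≤e = lemma (b v) g d≤e
    where
    lemma : ∀ c g {d e} → d ≤ e → c + (g - e + c) ≤ c + (g - d + c)
    lemma c g {d} {e} d≤e = linear d≤e (solve (c ∷ g ∷ d ∷ e ∷ []))

  γ-from : (v : V) → (∀ {u} → u ≺ v → ℤ) → ℤ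
  γ-from v below with toℕ v ℕ.≟ 0
  ... | yes _ = 0ℤ
  ... | no  _ = proj₁ (greatest (b v) v (λ u u≺v → gain v (below u≺v)) (λ u u≺v → gain-anti v (below u≺v)))

  γ-from-cong : ∀ v {below below′ : ∀ {u} → u ≺ v → ℤ} →
                (∀ {u} (u≺v : u ≺ v) → below u≺v ≡ below′ u≺v) → γ-from v below ≡ γ-from v below′
  γ-from-cong v below≡ with toℕ v ℕ.≟ 0
  ... | yes _ = refl
  ... | no  _ = greatest-cong {v = v} refl λ u u≺v d → cong (λ g → gain v g d) (below≡ u≺v)

  abstract
    γ : V → ℤ
    γ = WF.All.wfRec <-wellFounded 0ℓ (λ _ → ℤ) γ-from

    γ-unfold : ∀ v → γ v ≡ γ-from v (λ {u} _ → γ u)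
    γ-unfold v = WF.FixPoint.unfold-wfRec <-wellFounded (λ _ → ℤ) γ-from γ-from-cong {v}

  γ-first : ∀ v → toℕ v ≡ 0 → γ v ≡ 0ℤ
  γ-first v v≡0 with toℕ v ℕ.≟ 0 | γ-unfold v
  ... | yes _ | γ≡ = γ≡
  ... | no v≢0 | _ = contradiction v≡0 v≢0

  γ-greatest : ∀ v → toℕ v ≢ 0 → Max.Least (Candidate (b v) v (λ u _ → gain v (γ u))) (γ v)
  γ-greatest v v≢0 with toℕ v ℕ.≟ 0 | γ-unfold v
  ... | yes v≡0 | _ = contradiction v≡0 v≢0
  ... | no _ | γ≡ = subst (Max.Least _) (sym γ≡) (proj₂ (greatest (b v) v _ _))

  γ-isGamma : IsGamma Ψ γ
  γ-isGamma v = γ-first v , λ v≢0 → step (γ-greatest v v≢0)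
    where
    step : Max.Least (Candidate (b v) v (λ u _ → gain v (γ u))) (γ v) → GammaStep Ψ γ v
    step (cand , ub) =
      ub (inj₁ refl) , (λ u d u≺v δ → ub (inj₂ (u , u≺v , d , IsDelta⇒Delta δ , refl))) , attained cand
      where
      attained : Candidate (b v) v (λ u _ → gain v (γ u)) (γ v) → _
      attained (inj₁ γ≡) = inj₁ γ≡
      attained (inj₂ (u , u≺v , d , δ , γ≡)) = inj₂ (u , d , u≺v , Delta⇒IsDelta δ , γ≡)

-- Parity of walk weights in a bipartite graph

module Colouring (Ψ : Instance) (bipartite : Bipartite Ψ) where
  open Walks Ψ

  colour : V → ℤ
  colour v = if proj₁ bipartite v then 1ℤ else 0ℤ

  colour-adj : ∀ {u w} → Adj Ψ u w → 1ℤ + colour u ≡₂ colour w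
  colour-adj {u} {w} a with proj₁ bipartite u | proj₁ bipartite w | proper a
    where
    proper : Adj Ψ u w → proj₁ bipartite u ≢ proj₁ bipartite w
    proper (inj₁ uw) = All.lookup (proj₂ bipartite) uw
    proper (inj₂ wu) = All.lookup (proj₂ bipartite) wu ∘ sym
  ... | true  | false | _ = double 1ℤ refl
  ... | false | true  | _ = double 0ℤ refl
  ... | true  | true  | ≢ = contradiction refl ≢
  ... | false | false | ≢ = contradiction refl ≢

  -- Every edge changes the colour, and the correction at a split vertex is even.
  weight-colour : ∀ {u w d} → Weight u w d → d + colour u ≡₂ colour w
  weight-colour (edge _ a) = colour-adj a
  weight-colour (split {u} {z} {w} {d} {e} p q _ _ _) =
    lemma (b z) d e (colour u) (colour z) (colour w) (weight-colour p) (weight-colour q)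
    where
    lemma : ∀ c d e x y t → d + x ≡₂ y → e + y ≡₂ t → d + e - (c + c) + x ≡₂ t
    lemma c d e x y t f g = Even-resp (Even-+ (Even-+ f g) (double (- c) refl))
      (solve (c ∷ d ∷ e ∷ x ∷ y ∷ t ∷ []))

  ≢-weight : ∀ {u w d} → Weight u w d → u ≢ w
  ≢-weight (edge u≢w _) = u≢w
  ≢-weight (split _ _ u≢w _ _) = u≢w

-- Quantifier order, assignments and distance from the middle

-- Rest j vs: vs lists the variables j, j+1, …, k−1 that are still to be quantified.
data Rest {k : ℕ} : ℕ → List (Fin k) → Set where
  []   : Rest k []
  _∷_  : ∀ {j v vs} → toℕ v ≡ j → Rest (suc j) vs → Rest j (v ∷ vs)

rest-all : ∀ k → Rest {k} 0 (allFin k)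
rest-all k = go k 0 (λ i → i) (λ _ → refl) refl
  where
  go : ∀ {k} l j (f : Fin l → Fin k) → (∀ i → toℕ (f i) ≡ j ℕ.+ toℕ i) → j ℕ.+ l ≡ k →
       Rest j (tabulate f)
  go zero j f f≡ j≡ = subst (λ i → Rest i []) (trans (sym j≡) (ℕ.+-identityʳ j)) []
  go (suc l) j f f≡ j≡ = trans (f≡ zero) (ℕ.+-identityʳ j) ∷
    go l (suc j) (f ∘ suc) (λ i → trans (f≡ (suc i)) (ℕ.+-suc j (toℕ i)))
       (trans (sym (ℕ.+-suc j l)) j≡)

-- The argument witnesses that `k` is positive. The first variable serves as the reference vertex
-- for parity classes.
first : ∀ {k} → Fin k → Fin k
first {suc k} _ = zero

toℕ-first : ∀ {k} (v : Fin k) → toℕ (first v) ≡ 0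
toℕ-first {suc k} _ = refl

first-constant : ∀ {k} (v w : Fin k) → first v ≡ first w
first-constant {suc k} _ _ = refl

first-≺ : ∀ {k} (v : Fin k) → toℕ v ≢ 0 → first v ≺ v
first-≺ {suc k} v v≢0 = ℕ.n≢0⇒n>0 v≢0

module _ {k} {A : Set} (ρ : Fin k → A) (v : Fin k) (x : A) where
  update-same : update ρ v x v ≡ x
  update-same with v Fin.≟ v
  ... | yes _  = refl
  ... | no v≢v = contradiction refl v≢v

  update-other : ∀ {u} → u ≢ v → update ρ v x u ≡ ρ u
  update-other {u} u≢v with u Fin.≟ v
  ... | yes u≡v = contradiction u≡v u≢v
  ... | no _    = refl

  update-below : ∀ {u} → u ≺ v → update ρ v x u ≡ ρ u
  update-below u≺v = update-other λ { refl → ℕ.<-irrefl refl u≺v }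

-- With positions 0, …, 2K−1, x is at distance at least g from the middle pair K−1, K.
Outside : ℤ → ℤ → ℤ → Set
Outside K g x = x + 1ℤ + g ≤ K ⊎ K + g ≤ x

<⇒+1≤ : ∀ {x y} → x < y → x + 1ℤ ≤ y
<⇒+1≤ {x} x<y = ℤ.≤-trans (ℤ.≤-reflexive (ℤ.+-comm x 1ℤ)) (ℤ.i<j⇒suc[i]≤j x<y)

parity-gap : ∀ {x y} → x ≡₂ y → x ≢ y → x + (1ℤ + 1ℤ) ≤ y ⊎ y + (1ℤ + 1ℤ) ≤ x
parity-gap {x} {y} e x≢y = Sum.map (widen (≡₂-sym {x} e)) (widen e) (strict (ℤ.<-cmp x y))
  where
  strict : Tri (x < y) (x ≡ y) (y < x) → x < y ⊎ y < x
  strict (tri< x<y _ _) = inj₁ x<y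
  strict (tri≈ _ x≡y _) = contradiction x≡y x≢y
  strict (tri> _ _ y<x) = inj₂ y<x

  widen : ∀ {x y} → y ≡₂ x → x < y → x + (1ℤ + 1ℤ) ≤ y
  widen {x} {y} e x<y = Even-sharpen
    (Even-resp (Even-+ e (double (- 1ℤ) refl)) (solve (x ∷ y ∷ [])))
    (linear (<⇒+1≤ x<y) (solve (x ∷ y ∷ [])))

-- Consequences of truth on a structure placed in the integers

module Play (Ψ : Instance) (connected : Connected Ψ) (bipartite : Bipartite Ψ)
  (B : Str) (pos : D B → ℤ) (pos-injective : ∀ {x y} → pos x ≡ pos y → x ≡ y)
  (pos-edge : ∀ {x y} → E B x y → pos x + 1ℤ ≡ pos y ⊎ pos y + 1ℤ ≡ pos x) where
  open Walks Ψ
  open Colouring Ψ bipartite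

  Assignment : Set
  Assignment = V → D B

  class : Assignment → V → ℤ
  class f v = pos (f v) + colour v

  hom-adj : ∀ {f u w} → Hom Ψ B f → Adj Ψ u w →
            pos (f u) + 1ℤ ≡ pos (f w) ⊎ pos (f w) + 1ℤ ≡ pos (f u)
  hom-adj hom (inj₁ uw) = pos-edge (All.lookup hom uw)
  hom-adj hom (inj₂ wu) = swap (pos-edge (All.lookup hom wu))

  -- Along an edge both the value and the colour change parity, so their sum keeps its own;
  -- connectedness carries this to any two vertices.
  hom-class : ∀ {f} → Hom Ψ B f → ∀ u w → class f u ≡₂ class f w
  hom-class {f} hom u w = go (connected u w)
    where
    shift : ∀ x y s t → x + 1ℤ ≡ y ⊎ y + 1ℤ ≡ x → 1ℤ + s ≡₂ t → x + s ≡₂ y + t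
    shift x _ s t (inj₁ refl) e = Even-resp (Even-+ e (double (- 1ℤ) refl)) (solve (x ∷ s ∷ t ∷ []))
    shift _ y s t (inj₂ refl) e = Even-resp e (solve (y ∷ s ∷ t ∷ []))

    go : ∀ {u w} → Star (Adj Ψ) u w → class f u ≡₂ class f w
    go {u} ε = ≡₂-refl {class f u}
    go {w = w} (_◅_ {u} {v} a as) =
      ≡₂-trans {class f u} {class f v} {class f w}
        (shift (pos (f u)) (pos (f v)) (colour u) (colour v) (hom-adj hom a) (colour-adj a)) (go as)

  Agree : ℕ → Assignment → Assignment → Set
  Agree k f g = ∀ {u} → toℕ u ℕ.< k → f u ≡ g u

  agree-update : ∀ {k f ρ v x} → toℕ v ≡ k → Agree (suc k) f (update ρ v x) → Agree k f ρ
  agree-update {ρ = ρ} {v} {x} refl agree u<k =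
    trans (agree (ℕ.m<n⇒m<1+n u<k)) (update-below ρ v x u<k)

  offers : ∀ {ρ v vs} → Sat Ψ B ρ (v ∷ vs) →
    Σ[ x ∈ D B ] Σ[ y ∈ D B ] Sat Ψ B (update ρ v x) vs × Sat Ψ B (update ρ v y) vs ×
      (b v ≡ 0ℤ ⊎ b v ≡ 1ℤ × x ≢ y)
  offers {v = v} sat with two Ψ v
  ... | false = let x , s = sat in x , x , s , s , inj₁ refl
  ... | true  = let x , y , x≢y , s , t = sat in x , y , s , t , inj₂ (refl , x≢y)

  complete : ∀ {k ρ vs} → Rest k vs → Sat Ψ B ρ vs → Σ[ f ∈ Assignment ] Hom Ψ B f × Agree k f ρ
  complete {ρ = ρ} [] hom = ρ , hom , λ _ → refl
  complete (v≡k ∷ rest) sat =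
    let x , _ , s , _ = offers sat
        f , hom , agree = complete rest s
    in f , hom , agree-update v≡k agree

  -- The choices made before the turn of `z` do not matter to the later arguments, so the first
  -- offer is taken each time.
  advance : ∀ {k ρ vs} → Rest k vs → Sat Ψ B ρ vs → ∀ z → k ℕ.≤ toℕ z →
    Σ[ ρ′ ∈ Assignment ] Σ[ vs′ ∈ List V ]
      Rest (suc (toℕ z)) vs′ × Sat Ψ B ρ′ (z ∷ vs′) × Agree k ρ′ ρ
  advance [] sat z m≤z = contradiction (Fin.toℕ<n z) (ℕ.≤⇒≯ m≤z)
  advance {k} {ρ} {v ∷ vs} (v≡k ∷ rest) sat z k≤z with toℕ z ℕ.≟ k
  ... | yes z≡k with refl ← Fin.toℕ-injective (trans z≡k (sym v≡k)) =
    ρ , vs , subst (λ j → Rest (suc j) vs) (sym v≡k) rest , sat , λ _ → refl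
  ... | no z≢k =
    let x , _ , s , _ = offers sat
        ρ′ , vs′ , rest′ , sat′ , agree = advance rest s z (ℕ.≤∧≢⇒< k≤z (z≢k ∘ sym))
    in ρ′ , vs′ , rest′ , sat′ , agree-update v≡k agree

  value-class : ∀ {ρ z x vs} → Rest (suc (toℕ z)) vs → Sat Ψ B (update ρ z x) vs →
                ∀ {u} → u ≺ z → pos x + colour z ≡₂ class ρ u
  value-class {ρ} {z} {x} rest sat {u} u≺z =
    let f , hom , agree = complete rest sat
    in subst₂ (λ x y → pos x + colour z ≡₂ pos y + colour u)
         (trans (agree ℕ.≤-refl) (update-same ρ z x)) (agree-update refl agree u≺z) (hom-class hom z u)

  -- The two offers have equal parity, since both extend to homomorphisms of a connected graph.
  spread : ∀ {ρ z vs} → Rest (suc (toℕ z)) vs → Sat Ψ B ρ (z ∷ vs) → ∀ {u} → u ≺ z →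
    Σ[ lo ∈ D B ] Σ[ hi ∈ D B ] Sat Ψ B (update ρ z lo) vs × Sat Ψ B (update ρ z hi) vs ×
      pos lo + (b z + b z) ≤ pos hi
  spread {ρ} {z} rest sat {u} u≺z with offers sat
  ... | x , _ , s , _ , inj₁ b≡0 = x , x , s , s ,
    subst (λ c → pos x + (c + c) ≤ pos x) (sym b≡0) (ℤ.≤-reflexive (ℤ.+-identityʳ (pos x)))
  ... | x , y , s , t , inj₂ (b≡1 , x≢y)
    with parity-gap (cancel (pos x) (pos y) (colour z)
           (≡₂-trans {pos x + colour z} {class ρ u} (value-class rest s u≺z)
             (≡₂-sym {pos y + colour z} (value-class rest t u≺z))))
           (x≢y ∘ pos-injective)
    where
    cancel : ∀ x y c → x + c ≡₂ y + c → x ≡₂ y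
    cancel x y c e = Even-resp e (solve (x ∷ y ∷ c ∷ []))
  ...   | inj₁ x<y = x , y , s , t , subst (λ c → pos x + (c + c) ≤ pos y) (sym b≡1) x<y
  ...   | inj₂ y<x = y , x , t , s , subst (λ c → pos y + (c + c) ≤ pos x) (sym b≡1) y<x

  -- The last hypothesis stops the play right after the later of `u` and `w`, so a split vertex `z`
  -- is still to come. The bound for `u` and `z` is used in the play where `z` gets the low offer,
  -- the bound for `z` and `w` in the play where it gets the high one; their gap of 2(β(z) - 1) is
  -- the gain.
  weight-bound : ∀ {u w d} → Weight u w d → ∀ {k ρ vs} → Rest k vs → Sat Ψ B ρ vs →
    toℕ u ℕ.< k → toℕ w ℕ.< k → k ℕ.≤ suc (toℕ u) ⊎ k ℕ.≤ suc (toℕ w) →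
    pos (ρ u) - pos (ρ w) ≤ d
  weight-bound {u} {w} (edge _ a) {ρ = ρ} rest sat u<k w<k _ with complete rest sat
  ... | f , hom , agree = subst₂ (λ x y → pos x - pos y ≤ 1ℤ) (agree u<k) (agree w<k)
    (close (pos (f u)) (pos (f w)) (hom-adj hom a))
    where
    close : ∀ x y → x + 1ℤ ≡ y ⊎ y + 1ℤ ≡ x → x - y ≤ 1ℤ
    close x _ (inj₁ refl) = linear (-≤+ {0} {1}) (solve (x ∷ []))
    close _ y (inj₂ refl) = ℤ.≤-reflexive (solve (y ∷ []))
  weight-bound {u} {w} (split {z = z} {d = d} {e} p q _ u≺z w≺z) {k} {ρ} rest sat u<k w<k near
    with advance rest sat z (Sum.[ (λ le → ℕ.≤-trans le u≺z) , (λ le → ℕ.≤-trans le w≺z) ] near)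
  ... | ρ′ , vs′ , rest′ , sat′ , agree with spread rest′ sat′ u≺z
  ... | lo , hi , s , t , lo+2b≤hi = combine (pos (ρ u)) (pos (ρ w)) (pos lo) (pos hi) d e (b z)
    (subst₂ (λ x y → pos x - pos y ≤ d)
      (trans (update-below ρ′ z lo u≺z) (agree u<k)) (update-same ρ′ z lo)
      (weight-bound p rest′ s (ℕ.m<n⇒m<1+n u≺z) ℕ.≤-refl (inj₂ ℕ.≤-refl)))
    (subst₂ (λ x y → pos x - pos y ≤ e)
      (update-same ρ′ z hi) (trans (update-below ρ′ z hi w≺z) (agree w<k))
      (weight-bound q rest′ t ℕ.≤-refl (ℕ.m<n⇒m<1+n w≺z) (inj₁ ℕ.≤-refl)))
    lo+2b≤hi
    where
    combine : ∀ x y l h d e c → x - l ≤ d → h - y ≤ e → l + (c + c) ≤ h → x - y ≤ d + e - (c + c)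
    combine x y l h d e c p q r = linear (p ⊕ q ⊕ r) (solve (x ∷ y ∷ l ∷ h ∷ d ∷ e ∷ c ∷ []))

  offer-bounds : ∀ {u z d ρ x vs} → Weight u z d → u ≺ z → Rest (suc (toℕ z)) vs →
    Sat Ψ B (update ρ z x) vs → pos (ρ u) - pos x ≤ d × pos x - pos (ρ u) ≤ d
  offer-bounds {u} {z} {d} {ρ} {x} p u≺z rest sat =
    subst₂ (λ x y → pos x - pos y ≤ d) (update-below ρ z x u≺z) (update-same ρ z x)
      (weight-bound p rest sat (ℕ.m<n⇒m<1+n u≺z) ℕ.≤-refl (inj₂ ℕ.≤-refl)) ,
    subst₂ (λ x y → pos x - pos y ≤ d) (update-same ρ z x) (update-below ρ z x u≺z)
      (weight-bound (Weight-sym p) rest sat ℕ.≤-refl (ℕ.m<n⇒m<1+n u≺z) (inj₁ ℕ.≤-refl))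

  -- Both offers at `v` lie within `d` of the value of `u`, so their gap of at least `b v + b v` is
  -- at most `d + d`.
  b≤weight : ∀ {ρ} → Sat Ψ B ρ (allFin (m Ψ)) → ∀ {u v d} → Weight u v d → u ≺ v → b v ≤ d
  b≤weight sat {u} {v} {d} p u≺v with advance (rest-all (m Ψ)) sat v z≤n
  ... | ρ , _ , rest , sat′ , _ with spread rest sat′ u≺v
  ... | lo , hi , s , t , lo+2b≤hi = halve (b v) d
    (linear (proj₁ (offer-bounds p u≺v rest s) ⊕ proj₂ (offer-bounds p u≺v rest t) ⊕ lo+2b≤hi)
      (regroup (pos (ρ u)) (pos lo) (pos hi) d (b v)))
    where
    regroup : ∀ x l h d c → (d + (d + h)) - ((x - l) + ((h - x) + (l + (c + c)))) ≡ (d + d) - (c + c)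
    regroup x l h d c = solve (x ∷ l ∷ h ∷ d ∷ c ∷ [])
    halve : ∀ c d → c + c ≤ d + d → c ≤ d
    halve c d 2c≤2d = ℤ.≮⇒≥ λ d<c → ℤ.<⇒≱ (ℤ.+-mono-< d<c d<c) 2c≤2d

  -- Adversary's strategy

  adversary-step : ∀ K {ρ v vs} → Rest (suc (toℕ v)) vs → Sat Ψ B ρ (v ∷ vs) →
    (∀ u → u ≺ v → Outside K (γ u) (pos (ρ u))) →
    Σ[ x ∈ D B ] Sat Ψ B (update ρ v x) vs × Outside K (γ v) (pos x)
  adversary-step K {ρ} {v} rest sat out with toℕ v ℕ.≟ 0
  ... | yes v≡0 =
    let x , _ , s , _ = offers sat
    in x , s , subst (λ g → Outside K g (pos x)) (sym (γ-first v v≡0)) (outside₀ (pos x))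
    where
    outside₀ : ∀ x → Outside K 0ℤ x
    outside₀ x with ℤ.<-cmp x K
    ... | tri< x<K _ _ = inj₁ (linear (<⇒+1≤ x<K) (solve (x ∷ K ∷ [])))
    ... | tri≈ _ refl _ = inj₂ (ℤ.≤-reflexive (ℤ.+-identityʳ K))
    ... | tri> _ _ K<x = inj₂ (ℤ.≤-trans (ℤ.≤-reflexive (ℤ.+-identityʳ K)) (ℤ.<⇒≤ K<x))
  ... | no v≢0 with γ-greatest v v≢0
  ... | inj₁ γ≡b , _ with spread rest sat (first-≺ v v≢0)
  ...   | lo , hi , s , t , lo+2b≤hi with pos lo + 1ℤ + b v ≤? K
  ...     | yes left = lo , s , subst (λ g → Outside K g (pos lo)) (sym γ≡b) (inj₁ left)
  -- Here `pos lo` is at least `K - b v`, so the gap puts `hi` at or beyond `K + b v`.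
  ...     | no ¬left = hi , t , subst (λ g → Outside K g (pos hi)) (sym γ≡b)
    (inj₂ (right (pos lo) (pos hi) (b v) lo+2b≤hi (<⇒+1≤ (ℤ.≰⇒> ¬left))))
    where
    right : ∀ l h c → l + (c + c) ≤ h → K + 1ℤ ≤ l + 1ℤ + c → K + c ≤ h
    right l h c p q = linear (p ⊕ q) (solve (l ∷ h ∷ c ∷ K ∷ []))
  adversary-step K {ρ} {v} rest sat out | no v≢0 | inj₂ (u , u≺v , d , (p , _) , γ≡) , _
    with spread rest sat u≺v | out u u≺v
  -- The high offer is at most `d` to the right of `u`, so the low one is at most `d` - 2`b v` to
  -- its right; this leaves γ(u) - d + 2(β(v) - 1), which is γ(v). The other side is the mirror
  -- image.
  ... | lo , hi , s , t , lo+2b≤hi | inj₁ left = lo , s ,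
    subst (λ g → Outside K g (pos lo)) (sym γ≡) (inj₁ (lemma (pos (ρ u)) (pos lo) (pos hi) (b v) (γ u) d
      left lo+2b≤hi (proj₂ (offer-bounds p u≺v rest t))))
    where
    lemma : ∀ x l h c g d → x + 1ℤ + g ≤ K → l + (c + c) ≤ h → h - x ≤ d →
            l + 1ℤ + (c + (g - d + c)) ≤ K
    lemma x l h c g d p q r = linear (p ⊕ q ⊕ r) (solve (x ∷ l ∷ h ∷ c ∷ g ∷ d ∷ K ∷ []))
  ... | lo , hi , s , t , lo+2b≤hi | inj₂ right = hi , t ,
    subst (λ g → Outside K g (pos hi)) (sym γ≡) (inj₂ (lemma (pos (ρ u)) (pos lo) (pos hi) (b v) (γ u) d
      right lo+2b≤hi (proj₁ (offer-bounds p u≺v rest s))))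
    where
    lemma : ∀ x l h c g d → K + g ≤ x → l + (c + c) ≤ h → x - l ≤ d → K + (c + (g - d + c)) ≤ h
    lemma x l h c g d p q r = linear (p ⊕ q ⊕ r) (solve (x ∷ l ∷ h ∷ c ∷ g ∷ d ∷ K ∷ []))

  adversary : ∀ K {k ρ vs} → Rest k vs → Sat Ψ B ρ vs →
    (∀ u → toℕ u ℕ.< k → Outside K (γ u) (pos (ρ u))) →
    Σ[ f ∈ Assignment ] (∀ v → Outside K (γ v) (pos (f v)))
  adversary K {ρ = ρ} [] _ out = ρ , λ v → out v (Fin.toℕ<n v)
  adversary K {ρ = ρ} {v ∷ vs} (refl ∷ rest) sat out with adversary-step K rest sat out
  ... | x , s , out-v = adversary K rest s λ u u<k → extend u (ℕ.m≤n⇒m<n∨m≡n (ℕ.≤-pred u<k))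
    where
    extend : ∀ u → toℕ u ℕ.< toℕ v ⊎ toℕ u ≡ toℕ v → Outside K (γ u) (pos (update ρ v x u))
    extend u (inj₁ u≺v) = subst (Outside K (γ u) ∘ pos) (sym (update-below ρ v x u≺v)) (out u u≺v)
    extend u (inj₂ u≡v) with refl ← Fin.toℕ-injective u≡v =
      subst (Outside K (γ u) ∘ pos) (sym (update-same ρ v x)) out-v

¬Even-1 : ¬ Even 1ℤ
¬Even-1 e with Even-nonneg (Even-neg e) ℤ.≤-refl
... | ()

-- From a winning strategy to the truth of the sentence

module _ (Ψ : Instance) (B : Str) (σ : Strategy Ψ B) where
  open Walks Ψ using (V)

  picked-cong : ∀ {f g v} β → f v ≡ g v → σ v f ≡ σ v g → Picked Ψ B σ f v β → Picked Ψ B σ g v β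
  picked-cong false f≡g σ≡ p = trans (sym f≡g) (trans p (cong proj₁ σ≡))
  picked-cong true  f≡g σ≡ = Sum.map
    (λ p → trans (sym f≡g) (trans p (cong proj₁ σ≡)))
    (λ p → trans (sym f≡g) (trans p (cong proj₂ σ≡)))

  -- By locality an offer does not change when its own variable or a later one is overwritten. Hence
  -- the picks made so far remain legal, and each complete assignment is a play.
  winning⇒sat : ValidStrategy Ψ B σ → ((f : V → D B) → PlayedBy Ψ B σ f → Hom Ψ B f) →
    ∀ {k ρ vs} → Rest k vs → (∀ v → toℕ v ℕ.< k → Picked Ψ B σ ρ v (two Ψ v)) → Sat Ψ B ρ vs
  winning⇒sat _ wins [] played = wins _ λ v → played v (Fin.toℕ<n v)
  winning⇒sat valid@(distinct , local) wins {ρ = ρ} {v ∷ vs} (refl ∷ rest) played = choose (two Ψ v) refl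
    where
    same-offer : ∀ x {u} → toℕ u ℕ.≤ toℕ v → σ u ρ ≡ σ u (update ρ v x)
    same-offer x {u} u≤v = local u ρ _ λ t t≺u → sym (update-below ρ v x (ℕ.<-≤-trans t≺u u≤v))

    extend : ∀ x → Picked Ψ B σ (update ρ v x) v (two Ψ v) → ∀ u → toℕ u ℕ.< suc (toℕ v) →
             Picked Ψ B σ (update ρ v x) u (two Ψ u)
    extend x picked u u<sv with ℕ.m≤n⇒m<n∨m≡n (ℕ.≤-pred u<sv)
    ... | inj₁ u≺v = picked-cong (two Ψ u) (sym (update-below ρ v x u≺v))
                       (same-offer x (ℕ.<⇒≤ u≺v)) (played u u≺v)
    ... | inj₂ u≡v with refl ← Fin.toℕ-injective u≡v = picked

    continue : ∀ x → Picked Ψ B σ (update ρ v x) v (two Ψ v) → Sat Ψ B (update ρ v x) vs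
    continue x picked = winning⇒sat valid wins rest (extend x picked)

    choose : ∀ β → two Ψ v ≡ β → SatQ Ψ B ρ v β vs
    choose false β≡ = proj₁ (σ v ρ) , continue _ (subst (Picked Ψ B σ _ v) (sym β≡)
      (trans (update-same ρ v _) (cong proj₁ (same-offer _ ℕ.≤-refl))))
    choose true β≡ = proj₁ (σ v ρ) , proj₂ (σ v ρ) , distinct v ρ β≡ ,
      continue _ (subst (Picked Ψ B σ _ v) (sym β≡)
        (inj₁ (trans (update-same ρ v _) (cong proj₁ (same-offer _ ℕ.≤-refl))))) ,
      continue _ (subst (Picked Ψ B σ _ v) (sym β≡)
        (inj₂ (trans (update-same ρ v _) (cong proj₂ (same-offer _ ℕ.≤-refl)))))

-- Parity alignment and positions on an even path

align : ℤ → ℤ → ℤ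
align x t with parity (x - t)
... | inj₁ _ = x
... | inj₂ _ = x + 1ℤ

align-≡₂ : ∀ x t → align x t ≡₂ t
align-≡₂ x t with parity (x - t)
... | inj₁ e = e
... | inj₂ e = shift x t e
  where
  shift : ∀ x t → Even (x - t + 1ℤ) → x + 1ℤ ≡₂ t
  shift x t e = Even-resp e (solve (x ∷ t ∷ []))

≤-align : ∀ x t → x ≤ align x t
≤-align x t with parity (x - t)
... | inj₁ _ = ℤ.≤-refl
... | inj₂ _ = ℤ.i≤i+j x 1ℤ

align-≤ : ∀ x t → align x t ≤ x + 1ℤ
align-≤ x t with parity (x - t)
... | inj₁ _ = ℤ.i≤i+j x 1ℤ
... | inj₂ _ = ℤ.≤-refl

pos : ∀ {n} → Fin n → ℤ
pos i = + toℕ i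

pos-injective : ∀ {n} {i j : Fin n} → pos i ≡ pos j → i ≡ j
pos-injective = Fin.toℕ-injective ∘ ℤ.+-injective

module EvenPath (n : ℕ) (K : ℤ) (n≡2K : + n ≡ K + K) (2≤K : 1ℤ + 1ℤ ≤ K) where
  2≤2K : 1ℤ + 1ℤ ≤ K + K
  2≤2K = ℤ.≤-trans (+≤+ {2} {4} (s≤s (s≤s z≤n))) (2≤K ⊕ 2≤K)

  1≤2K : 1ℤ ≤ K + K
  1≤2K = ℤ.≤-trans (+≤+ {1} {2} (s≤s z≤n)) 2≤2K

  0<n : 0 ℕ.< n
  0<n = ℤ.drop‿+≤+ (subst (1ℤ ≤_) (sym n≡2K) 1≤2K)

  pos-bound : ∀ (i : Fin n) → pos i + 1ℤ ≤ K + K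
  pos-bound i = subst₂ _≤_ (ℤ.+-comm 1ℤ (pos i)) n≡2K (+≤+ (Fin.toℕ<n i))

  -- Integers off the path go to the default vertex at position 0; `pos-toFin` covers the range in
  -- which the offers of actual plays lie.
  toFin : ℤ → Fin n
  toFin (+ j) with j ℕ.<? n
  ... | yes j<n = fromℕ< j<n
  ... | no  _   = fromℕ< 0<n
  toFin -[1+ _ ] = fromℕ< 0<n

  pos-toFin : ∀ {x} → 0ℤ ≤ x → x + 1ℤ ≤ K + K → pos (toFin x) ≡ x
  pos-toFin {+ j} _ j<2K with j ℕ.<? n
  ... | yes j<n = cong +_ (Fin.toℕ-fromℕ< j<n)
  ... | no  j≮n = contradiction
    (ℤ.drop‿+≤+ (subst₂ _≤_ (ℤ.+-comm (+ j) 1ℤ) (sym n≡2K) j<2K)) j≮n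

  toFin0≢toFin1 : toFin 0ℤ ≢ toFin 1ℤ
  toFin0≢toFin1 eq with () ←
    trans (sym (pos-toFin {0ℤ} ℤ.≤-refl 1≤2K)) (trans (cong pos eq) (pos-toFin {1ℤ} (+≤+ z≤n) 2≤2K))

  other : Fin n → Fin n → Fin n
  other i j with i Fin.≟ j | i Fin.≟ toFin 0ℤ
  ... | no _  | _     = j
  ... | yes _ | yes _ = toFin 1ℤ
  ... | yes _ | no _  = toFin 0ℤ

  other-≢ : ∀ i j → i ≢ other i j
  other-≢ i j with i Fin.≟ j | i Fin.≟ toFin 0ℤ
  ... | no i≢j | _      = i≢j
  ... | yes _  | yes i≡ = toFin0≢toFin1 ∘ trans (sym i≡)
  ... | yes _  | no i≢  = i≢

  other-≡ : ∀ {i j} → i ≢ j → other i j ≡ j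
  other-≡ {i} {j} i≢j with i Fin.≟ j | i Fin.≟ toFin 0ℤ
  ... | no _    | _ = refl
  ... | yes i≡j | _ = contradiction i≡j i≢j

  -- Strategies must offer distinct elements even against assignments that no play reaches.
  pair : ℤ → ℤ → Fin n × Fin n
  pair x y = toFin x , other (toFin x) (toFin y)

  pos-pair₂ : ∀ {x y} → 0ℤ ≤ x → x < y → y + 1ℤ ≤ K + K → pos (proj₂ (pair x y)) ≡ y
  pos-pair₂ {x} {y} 0≤x x<y y<2K = trans (cong pos (other-≡ x≢y)) pos-y
    where
    pos-y = pos-toFin (ℤ.≤-trans 0≤x (ℤ.<⇒≤ x<y)) y<2K
    pos-x = pos-toFin 0≤x (ℤ.≤-trans (ℤ.+-monoˡ-≤ 1ℤ (ℤ.<⇒≤ x<y)) y<2K)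
    x≢y : toFin x ≢ toFin y
    x≢y eq = ℤ.<-irrefl (trans (sym pos-x) (trans (cong pos eq) pos-y)) x<y

-- Prover's strategy

module Prover (Ψ : Instance) (bipartite : Bipartite Ψ)
  (b≤weight : ∀ {u v d} → Walks.Weight Ψ u v d → u ≺ v → Walks.b Ψ v ≤ d)
  (n : ℕ) (K : ℤ) (n≡2K : + n ≡ K + K) (2≤K : 1ℤ + 1ℤ ≤ K)
  (γ<K : ∀ v → Walks.γ Ψ v + 1ℤ ≤ K) where
  open Walks Ψ
  open Colouring Ψ bipartite
  open EvenPath n K n≡2K 2≤K

  Assignment : Set
  Assignment = V → Fin n

  class root : Assignment → V → ℤ
  class f v = pos (f v) + colour v
  root f v = class f (first v)

  -- The bound K−1−γ(v) need not have the parity that the colouring prescribes for v; align repairs this.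
  base : Assignment → V → ℤ
  base f v = align (K - 1ℤ - γ v) (root f v - colour v)

  lower : Assignment → (v u : V) → u ≺ v → ℤ → ℤ
  lower f v u _ d = pos (f u) - d

  -- The left end of an intersection of intervals is the greatest of their left ends.
  leftmost : ∀ f v → Σ ℤ (Max.Least (Candidate (base f v) v (lower f v)))
  leftmost f v = greatest (base f v) v (lower f v) λ u _ d≤e → ℤ.+-monoʳ-≤ (pos (f u)) (ℤ.neg-mono-≤ d≤e)

  strategy : Strategy Ψ (P n)
  strategy v f with toℕ v ℕ.≟ 0
  -- No parity class is fixed before the first move, so both ends of the middle edge may be offered,
  -- although they differ by only 1.
  ... | yes _ = pair (K - 1ℤ) K
  ... | no  _ = pair (proj₁ (leftmost f v)) (proj₁ (leftmost f v) + (1ℤ + 1ℤ))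

  valid : ValidStrategy Ψ (P n) strategy
  valid = distinct , local
    where
    distinct : ∀ v f → two Ψ v ≡ true → proj₁ (strategy v f) ≢ proj₂ (strategy v f)
    distinct v f _ with toℕ v ℕ.≟ 0
    ... | yes _ = other-≢ _ (toFin K)
    ... | no  _ = other-≢ _ (toFin (proj₁ (leftmost f v) + (1ℤ + 1ℤ)))

    local : ∀ v f g → (∀ u → u ≺ v → f u ≡ g u) → strategy v f ≡ strategy v g
    local v f g agree with toℕ v ℕ.≟ 0
    ... | yes _ = refl
    ... | no v≢0 = cong (λ x → pair x (x + (1ℤ + 1ℤ))) (greatest-cong {v = v}
      (cong (λ i → align (K - 1ℤ - γ v) (pos i + colour (first v) - colour v)) (agree (first v) (first-≺ v v≢0)))
      (λ u u≺v d → cong (λ i → pos i - d) (agree u u≺v)))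

  -- Prover's invariant. The middle edge joins `K - 1ℤ` and `K`, so the first two fields bound the
  -- distance from it by γ(v). Asking `close` for every weight amounts to closeness within δ.
  record Good (f : Assignment) (v : V) : Set where
    field
      left   : K ≤ pos (f v) + 1ℤ + γ v
      right  : pos (f v) ≤ K + γ v
      colour-class : class f v ≡₂ root f v
      close  : ∀ {u d} → u ≺ v → Weight u v d → pos (f u) - pos (f v) ≤ d × pos (f v) - pos (f u) ≤ d
  open Good

  good-near : ∀ {f u w d} → Good f u → Good f w → Weight u w d → pos (f u) - pos (f w) ≤ d
  good-near {f} {u} {w} gu gw p with ℕ.<-cmp (toℕ u) (toℕ w)
  ... | tri< u≺w _ _ = proj₁ (close gw u≺w p)
  ... | tri≈ _ u≡w _ = contradiction (Fin.toℕ-injective u≡w) (≢-weight p)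
  ... | tri> _ _ w≺u = proj₂ (close gu w≺u (Weight-sym p))

  picked-either : ∀ {f v} → Picked Ψ (P n) strategy f v (two Ψ v) →
    f v ≡ proj₁ (strategy v f) ⊎ b v ≡ 1ℤ × f v ≡ proj₂ (strategy v f)
  picked-either {f} {v} picked with two Ψ v
  ... | false = inj₁ picked
  ... | true  = Sum.map₂ (refl ,_) picked

  good-first : ∀ f v → toℕ v ≡ 0 → f v ≡ toFin (K - 1ℤ) ⊎ f v ≡ proj₂ (pair (K - 1ℤ) K) → Good f v
  good-first f v v≡0 picked = record
    { left = subst (λ g → K ≤ pos (f v) + 1ℤ + g) (sym γ≡0) (proj₁ (range positions))
    ; right = subst (λ g → pos (f v) ≤ K + g) (sym γ≡0) (proj₂ (range positions))
    ; colour-class = subst (λ w → class f v ≡₂ class f w) v≡first (≡₂-refl {class f v})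
    ; close = λ u≺v → contradiction v≡0 (ℕ.m<n⇒n≢0 u≺v)
    }
    where
    γ≡0 = γ-first v v≡0
    v≡first : v ≡ first v
    v≡first = Fin.toℕ-injective (trans v≡0 (sym (toℕ-first v)))

    0≤K-1 : 0ℤ ≤ K - 1ℤ
    0≤K-1 = ℤ.≤-trans (+≤+ {0} {1} z≤n) (linear 2≤K (solve (K ∷ [])))

    K+1≤2K : K + 1ℤ ≤ K + K
    K+1≤2K = ℤ.+-monoʳ-≤ K (ℤ.≤-trans (+≤+ {1} {2} (s≤s z≤n)) 2≤K)

    K-1<K : K - 1ℤ < K
    K-1<K = ℤ.≤-<-trans (ℤ.≤-reflexive (ℤ.+-comm K (- 1ℤ))) (ℤ.i≤pred[j]⇒i<j ℤ.≤-refl)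

    positions : pos (f v) ≡ K - 1ℤ ⊎ pos (f v) ≡ K
    positions = Sum.map
      (λ e → trans (cong pos e) (pos-toFin 0≤K-1 (ℤ.≤-trans (ℤ.+-monoˡ-≤ 1ℤ (ℤ.<⇒≤ K-1<K)) K+1≤2K)))
      (λ e → trans (cong pos e) (pos-pair₂ 0≤K-1 K-1<K K+1≤2K)) picked

    range : ∀ {x} → x ≡ K - 1ℤ ⊎ x ≡ K → K ≤ x + 1ℤ + 0ℤ × x ≤ K + 0ℤ
    range (inj₁ refl) = ℤ.≤-reflexive (solve (K ∷ [])) , linear (-≤+ {0} {0}) (solve (K ∷ []))
    range (inj₂ refl) = linear (+≤+ {0} {1} z≤n) (solve (K ∷ [])) , ℤ.≤-reflexive (solve (K ∷ []))

  module _ (f : Assignment) (v : V) (v≢0 : toℕ v ≢ 0) (good-below : ∀ u → u ≺ v → Good f u) where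
    M : ℤ
    M = proj₁ (leftmost f v)

    M-candidate : Candidate (base f v) v (lower f v) M
    M-candidate = proj₁ (proj₂ (leftmost f v))

    ≤M : ∀ {x} → Candidate (base f v) v (lower f v) x → x ≤ M
    ≤M = proj₂ (proj₂ (leftmost f v))

    b≤γ : b v ≤ γ v
    b≤γ = proj₂ (γ-greatest v v≢0) (inj₁ refl)

    -- The maxima defining γ and `M` mention only δ; through this lemma monotonicity extends their
    -- bounds to every weight.
    delta : ∀ {u d} → Weight u v d → Σ[ e ∈ ℤ ] Delta u v e × e ≤ d
    delta {u} p with leastWeight u v
    ... | inj₁ none = contradiction p none
    ... | inj₂ (e , δ) = e , δ , proj₂ δ p

    gain≤γ : ∀ {u d} → u ≺ v → Weight u v d → gain v (γ u) d ≤ γ v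
    gain≤γ {u} u≺v p =
      let e , δ , e≤d = delta p
      in ℤ.≤-trans (gain-anti v (γ u) e≤d) (proj₂ (γ-greatest v v≢0) (inj₂ (u , u≺v , e , δ , refl)))

    below-M : ∀ {u d} → u ≺ v → Weight u v d → pos (f u) - d ≤ M
    below-M {u} u≺v p =
      let e , δ , e≤d = delta p
      in ℤ.≤-trans (ℤ.+-monoʳ-≤ (pos (f u)) (ℤ.neg-mono-≤ e≤d)) (≤M (inj₂ (u , u≺v , e , δ , refl)))

    class-below : ∀ {u} → u ≺ v → class f u ≡₂ root f v
    class-below {u} u≺v = subst (λ w → class f u ≡₂ class f w) (first-constant u v)
      (colour-class (good-below u u≺v))

    -- The base has the right parity by alignment, the other left ends by `weight-colour`. Hence `M`
    -- lies in the class prescribed for `v`.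
    candidate-class : ∀ {x} → Candidate (base f v) v (lower f v) x → x + colour v ≡₂ root f v
    candidate-class (inj₁ refl) = move (base f v) (root f v) (colour v) (align-≡₂ (K - 1ℤ - γ v) _)
      where
      move : ∀ x r c → x ≡₂ r - c → x + c ≡₂ r
      move x r c e = Even-resp e (solve (x ∷ r ∷ c ∷ []))
    candidate-class (inj₂ (u , u≺v , d , (p , _) , refl)) =
      move (pos (f u)) d (colour u) (colour v) (root f v) (class-below u≺v) (weight-colour p)
      where
      move : ∀ x d c c′ r → x + c ≡₂ r → d + c ≡₂ c′ → x - d + c′ ≡₂ r
      move x d c c′ r e e′ = Even-resp (Even-+ e (Even-neg e′)) (solve (x ∷ d ∷ c ∷ c′ ∷ r ∷ []))

    upper-class : ∀ {u d} → u ≺ v → Weight u v d → Even (pos (f u) + d - (M + (b v + b v)))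
    upper-class {u} {d} u≺v p = move (pos (f u)) d (colour u) (colour v) (root f v) M (b v)
      (class-below u≺v) (weight-colour p) (candidate-class M-candidate)
      where
      move : ∀ x d c c′ r m b → x + c ≡₂ r → d + c ≡₂ c′ → m + c′ ≡₂ r → Even (x + d - (m + (b + b)))
      move x d c c′ r m b e e′ e″ =
        Even-resp (Even-+ (Even-+ (Even-+ e e′) (Even-neg e″)) (double (c′ - c - b) refl))
          (solve (x ∷ d ∷ c ∷ c′ ∷ r ∷ m ∷ b ∷ []))

    -- The aligned base is at most `K - γ v`, and `b v ≤ γ v`. For the left end of a vertex `u`, the
    -- invariant at `u` meets the recursion for γ.
    M+2b≤right : M + (b v + b v) ≤ K + γ v
    M+2b≤right = from M-candidate
      where
      from : ∀ {x} → Candidate (base f v) v (lower f v) x → x + (b v + b v) ≤ K + γ v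
      from (inj₁ refl) = lemma (base f v) (b v) (γ v) (align-≤ (K - 1ℤ - γ v) _) b≤γ
        where
        lemma : ∀ x c g → x ≤ K - 1ℤ - g + 1ℤ → c ≤ g → x + (c + c) ≤ K + g
        lemma x c g p q = linear (p ⊕ q ⊕ q) (solve (x ∷ c ∷ g ∷ K ∷ []))
      from (inj₂ (u , u≺v , d , (p , _) , refl)) =
        lemma (pos (f u)) d (b v) (γ u) (γ v) (right (good-below u u≺v)) (gain≤γ u≺v p)
        where
        lemma : ∀ x d c g g′ → x ≤ K + g → c + (g - d + c) ≤ g′ → x - d + (c + c) ≤ K + g′
        lemma x d c g g′ p q = linear (p ⊕ q) (solve (x ∷ d ∷ c ∷ g ∷ g′ ∷ K ∷ []))

    -- The base of M may overshoot K−1−γ(v) by one, which parity makes up for.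
    M+2b≤upper : ∀ {u d} → u ≺ v → Weight u v d → M + (b v + b v) ≤ pos (f u) + d
    M+2b≤upper {u} {d} u≺v p = Even-sharpen (upper-class u≺v p) (from M-candidate)
      where
      from : ∀ {x} → Candidate (base f v) v (lower f v) x → x + (b v + b v) ≤ pos (f u) + d + 1ℤ
      from (inj₁ refl) = lemma (base f v) (pos (f u)) d (b v) (γ u) (γ v)
          (align-≤ (K - 1ℤ - γ v) _) (left (good-below u u≺v)) (gain≤γ u≺v p)
        where
        lemma : ∀ x y d c g g′ → x ≤ K - 1ℤ - g′ + 1ℤ → K ≤ y + 1ℤ + g → c + (g - d + c) ≤ g′ →
                x + (c + c) ≤ y + d + 1ℤ
        lemma x y d c g g′ p q r = linear (p ⊕ q ⊕ r) (solve (x ∷ y ∷ d ∷ c ∷ g ∷ g′ ∷ K ∷ []))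
      from (inj₂ (w , w≺v , e , (q , _) , refl)) with w Fin.≟ u
      -- No looping walk joins `u` to itself, so the triangle inequality is replaced by the bound
      -- that comes from P∞ ⊨ Ψ: both weights are at least `b v`.
      ... | yes refl = lemma (pos (f u)) d e (b v) (b≤weight p u≺v) (b≤weight q u≺v)
        where
        lemma : ∀ y d e c → c ≤ d → c ≤ e → y - e + (c + c) ≤ y + d + 1ℤ
        lemma y d e c p q = linear (p ⊕ q ⊕ +≤+ {0} {1} z≤n) (solve (y ∷ d ∷ e ∷ c ∷ []))
      -- The two walks joined at `v` form a looping walk from `w` to `u` of weight
      -- `e + d - (b v + b v)`, for which closeness is already known.
      ... | no w≢u = lemma (pos (f w)) (pos (f u)) d e (b v)
          (good-near (good-below w w≺v) (good-below u u≺v) (split q (Weight-sym p) w≢u w≺v u≺v))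
        where
        lemma : ∀ x y d e c → x - y ≤ e + d - (c + c) → x - e + (c + c) ≤ y + d + 1ℤ
        lemma x y d e c p = linear (p ⊕ +≤+ {0} {1} z≤n) (solve (x ∷ y ∷ d ∷ e ∷ c ∷ []))

    -- The bound γ(v) < K enters here and in `M+2b<2K`: it keeps the interval from `K - 1ℤ - γ v` to
    -- `K + γ v` on the path.
    0≤M : 0ℤ ≤ M
    0≤M = lemma (γ v) (γ<K v) (≤-align (K - 1ℤ - γ v) _) (≤M (inj₁ refl))
      where
      lemma : ∀ g {x m} → g + 1ℤ ≤ K → K - 1ℤ - g ≤ x → x ≤ m → 0ℤ ≤ m
      lemma g {x} {m} p q r = linear (p ⊕ q ⊕ r) (solve (g ∷ x ∷ m ∷ K ∷ []))

    M+2b<2K : M + (b v + b v) + 1ℤ ≤ K + K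
    M+2b<2K = lemma (M + (b v + b v)) (γ v) M+2b≤right (γ<K v)
      where
      lemma : ∀ x g → x ≤ K + g → g + 1ℤ ≤ K → x + 1ℤ ≤ K + K
      lemma x g p q = linear (p ⊕ q) (solve (x ∷ g ∷ K ∷ []))

    M≤M+2b : M ≤ M + (b v + b v)
    M≤M+2b = lemma M (b v) (b≥0 v)
      where
      lemma : ∀ x c → 0ℤ ≤ c → x ≤ x + (c + c)
      lemma x c p = linear (p ⊕ p) (solve (x ∷ c ∷ []))

    M<2K : M + 1ℤ ≤ K + K
    M<2K = ℤ.≤-trans (ℤ.+-monoˡ-≤ 1ℤ M≤M+2b) M+2b<2K

    good-at : ∀ x → pos (f v) ≡ x → M ≤ x → x ≤ M + (b v + b v) → x ≡₂ M → Good f v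
    good-at x refl M≤x x≤M+2b x≡₂M = record
      { left = left′ (γ v) (≤-align (K - 1ℤ - γ v) _) (≤M (inj₁ refl)) M≤x
      ; right = ℤ.≤-trans x≤M+2b M+2b≤right
      ; colour-class = class′ x M (colour v) (root f v) x≡₂M (candidate-class M-candidate)
      ; close = λ {u} {d} u≺v p →
          after (pos (f u)) d (below-M u≺v p) M≤x , before (pos (f u)) d x≤M+2b (M+2b≤upper u≺v p)
      }
      where
      left′ : ∀ g {y m x} → K - 1ℤ - g ≤ y → y ≤ m → m ≤ x → K ≤ x + 1ℤ + g
      left′ g {y} {m} {x} p q r = linear (p ⊕ q ⊕ r) (solve (g ∷ y ∷ m ∷ x ∷ K ∷ []))
      class′ : ∀ x m c r → x ≡₂ m → m + c ≡₂ r → x + c ≡₂ r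
      class′ x m c r e e′ = Even-resp (Even-+ e e′) (solve (x ∷ m ∷ c ∷ r ∷ []))
      after : ∀ y d {m x} → y - d ≤ m → m ≤ x → y - x ≤ d
      after y d {m} {x} p q = linear (p ⊕ q) (solve (y ∷ d ∷ m ∷ x ∷ []))
      before : ∀ y d {m x} → x ≤ m → m ≤ y + d → x - y ≤ d
      before y d {m} {x} p q = linear (p ⊕ q) (solve (y ∷ d ∷ m ∷ x ∷ []))

    good-later : f v ≡ toFin M ⊎ b v ≡ 1ℤ × f v ≡ proj₂ (pair M (M + (1ℤ + 1ℤ))) → Good f v
    good-later (inj₁ f≡) =
      good-at M (trans (cong pos f≡) (pos-toFin 0≤M M<2K)) ℤ.≤-refl M≤M+2b (≡₂-refl {M})
    good-later (inj₂ (b≡1 , f≡)) = good-at (M + (1ℤ + 1ℤ))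
      (trans (cong pos f≡) (pos-pair₂ 0≤M M<M+2 (subst (λ c → M + (c + c) + 1ℤ ≤ K + K) b≡1 M+2b<2K)))
      (ℤ.<⇒≤ M<M+2) (ℤ.≤-reflexive (cong (λ c → M + (c + c)) (sym b≡1))) (double 1ℤ (lemma M))
      where
      M<M+2 : M < M + (1ℤ + 1ℤ)
      M<M+2 = ℤ.≤-<-trans (ℤ.≤-reflexive (sym (ℤ.+-identityʳ M)))
        (ℤ.+-monoʳ-< M (+<+ {0} {2} (s≤s z≤n)))
      lemma : ∀ m → m + (1ℤ + 1ℤ) - m ≡ 1ℤ + 1ℤ
      lemma m = solve (m ∷ [])

  good : ∀ {f} → PlayedBy Ψ (P n) strategy f → ∀ v → Good f v
  good {f} played = WF.All.wfRec <-wellFounded 0ℓ (Good f) λ v ih → step v (λ u → ih {u}) (picked-either (played v))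
    where
    step : ∀ v → (∀ u → u ≺ v → Good f u) →
           f v ≡ proj₁ (strategy v f) ⊎ b v ≡ 1ℤ × f v ≡ proj₂ (strategy v f) → Good f v
    step v below picked with toℕ v ℕ.≟ 0
    ... | yes v≡0 = good-first f v v≡0 (Sum.map₂ proj₂ picked)
    ... | no v≢0  = good-later f v v≢0 below picked

  -- An edge has weight 1, so the values differ by at most 1; the colours differ, so the values have
  -- opposite parity and cannot coincide.
  adjacent : ∀ {f u w} → PlayedBy Ψ (P n) strategy f → Adj Ψ u w → E (P n) (f u) (f w)
  adjacent {f} {u} {w} played a =
    Sum.map ℤ.+-injective ℤ.+-injective
      (consecutive (pos (f u)) (pos (f w)) odd-step
        (good-near (good played u) (good played w) (edge u≢w a))
        (good-near (good played w) (good played u) (edge (u≢w ∘ sym) (swap a))))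
    where
    loop : ∀ c → ¬ (1ℤ + c ≡₂ c)
    loop c e = ¬Even-1 (Even-resp e (solve (c ∷ [])))

    u≢w : u ≢ w
    u≢w u≡w = loop (colour w) (subst (λ v → 1ℤ + colour v ≡₂ colour w) u≡w (colour-adj a))

    odd-step : pos (f w) ≡₂ pos (f u) + 1ℤ
    odd-step = lemma (pos (f u)) (pos (f w)) (colour u) (colour w) (class f (first w))
      (subst (λ v → class f u ≡₂ class f v) (first-constant u w) (colour-class (good played u)))
      (colour-class (good played w)) (colour-adj a)
      where
      lemma : ∀ x y c c′ r → x + c ≡₂ r → y + c′ ≡₂ r → 1ℤ + c ≡₂ c′ → y ≡₂ x + 1ℤ
      lemma x y c c′ r e e′ e″ =
        Even-resp (Even-+ (Even-+ e′ (Even-neg e)) (Even-+ e″ (double (- 1ℤ) refl)))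
          (solve (x ∷ y ∷ c ∷ c′ ∷ r ∷ []))

    consecutive : ∀ x y → y ≡₂ x + 1ℤ → x - y ≤ 1ℤ → y - x ≤ 1ℤ → x + 1ℤ ≡ y ⊎ y + 1ℤ ≡ x
    consecutive x y e x-y≤1 y-x≤1 with ℤ.<-cmp x y
    ... | tri< x<y _ _ = inj₁ (ℤ.≤-antisym (<⇒+1≤ x<y) (linear y-x≤1 (solve (x ∷ y ∷ []))))
    ... | tri> _ _ y<x = inj₂ (ℤ.≤-antisym (<⇒+1≤ y<x) (linear x-y≤1 (solve (x ∷ y ∷ []))))
    ... | tri≈ _ refl _ = ⊥-elim (¬Even-1 (Even-resp (Even-neg e) (solve (x ∷ []))))

  wins : ProverWins Ψ (P n)
  wins = strategy , valid , λ f played → All.tabulate λ a → adjacent played (inj₁ a)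

-- The equivalence

-- Each side of the middle has only `K` positions, so no position is further than `K - 1ℤ` from the
-- middle edge.
outside⇒< : ∀ K x {g} → x + 1ℤ ≤ K + K → 0ℤ ≤ x → Outside K g x → g < K
outside⇒< K x {g} x<2K 0≤x out =
  ℤ.suc[i]≤j⇒i<j (ℤ.≤-trans (ℤ.≤-reflexive (ℤ.+-comm 1ℤ g)) (bound out))
  where
  bound : Outside K g x → g + 1ℤ ≤ K
  bound (inj₁ l) = linear (l ⊕ 0≤x) (solve (x ∷ g ∷ K ∷ []))
  bound (inj₂ r) = linear (r ⊕ x<2K) (solve (x ∷ g ∷ K ∷ []))

module HalfLength (q : ℕ) (4≤n : 4 ℕ.≤ q ℕ.* 2) (Ψ : Instance)
  (connected : Connected Ψ) (bipartite : Bipartite Ψ) (P∞⊨Ψ : P∞ ⊨ Ψ) where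
  open Walks Ψ using (V; γ)

  n : ℕ
  n = q ℕ.* 2

  K : ℤ
  K = + q

  n≡2K : + n ≡ K + K
  n≡2K = cong +_ (trans (ℕ.*-comm q 2) (cong (q ℕ.+_) (ℕ.+-identityʳ q)))

  -- `Line` turns P∞ ⊨ Ψ into the lower bound on weights that Prover needs; `Path` hosts Adversary's
  -- play on the finite path.
  module Line = Play Ψ connected bipartite P∞ (λ x → x) (λ e → e) (λ e → e)
  module Path = Play Ψ connected bipartite (P n) pos pos-injective
    (Sum.map (λ e → cong +_ e) (λ e → cong +_ e))

  2≤K : 1ℤ + 1ℤ ≤ K
  2≤K = +≤+ (ℕ.*-cancelʳ-≤ 2 q 2 4≤n)

  sat⇒bounded : P n ⊨ Ψ → ∀ v → γ v < K
  sat⇒bounded sat v =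
    -- The initial assignment is arbitrary, since every variable gets overwritten, and no variable
    -- is subject to the invariant at the start.
    let f , out = Path.adversary K (rest-all (m Ψ)) (sat (λ _ → EvenPath.toFin n K n≡2K 2≤K 0ℤ)) (λ _ ())
    in outside⇒< K (pos (f v)) (EvenPath.pos-bound n K n≡2K 2≤K (f v)) (+≤+ z≤n) (out v)

  bounded⇒wins : (∀ v → γ v < K) → ProverWins Ψ (P n)
  bounded⇒wins γ<K = Prover.wins Ψ bipartite (Line.b≤weight (P∞⊨Ψ (λ _ → 0ℤ)))
    n K n≡2K 2≤K (λ v → <⇒+1≤ (γ<K v))

  wins⇒sat : ProverWins Ψ (P n) → P n ⊨ Ψ
  wins⇒sat (σ , valid , wins) ρ = winning⇒sat Ψ (P n) σ valid wins (rest-all (m Ψ)) (λ _ ())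

theorem26 : (n : ℕ) → 4 ℕ.≤ n → 2 ∣ n → (Ψ : Instance) →
    Connected Ψ → Bipartite Ψ → P∞ ⊨ Ψ →
    Σ[ γ ∈ (Fin (m Ψ) → ℤ) ] IsGamma Ψ γ ×
    ((P n ⊨ Ψ) ⇔ ProverWins Ψ (P n)) ×
    (ProverWins Ψ (P n) ⇔ ((v : Fin (m Ψ)) → γ v < + (n / 2)))
theorem26 _ 4≤n (divides q refl) Ψ connected bipartite P∞⊨Ψ =
  Walks.γ Ψ , Walks.γ-isGamma Ψ ,
  -- The cycle (I) ⇒ (III) ⇒ (II) ⇒ (I) yields both equivalences; `m*n/n≡m` identifies n/2 with `q`.
  mk⇔ (bounded⇒wins ∘ sat⇒bounded) wins⇒sat ,
  mk⇔ (λ win v → subst (λ k → _ < + k) (sym (m*n/n≡m q 2)) (sat⇒bounded (wins⇒sat win) v))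
      (λ bound → bounded⇒wins λ v → subst (λ k → _ < + k) (m*n/n≡m q 2) (bound v))
  where open HalfLength q 4≤n Ψ connected bipartite P∞⊨Ψ
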